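{- Let $G=G(V,E)$ be a cycle on $2n+1$ vertices with $n\geq 1$. Then the acyclic orientations of $E$ that maximize the number of linear extensions (of the induced partial order on $V$) are exactly the almost bipartite orientations.
   Context: An acyclic orientation of $E$ induces a partial order on $V$ in which $u<v$ iff there is a directed path from $u$ to $v$; a linear extension is a bijection $f:V\to[|V|]$ with $f(u)<f(v)$ whenever $(u,v)$ is a directed edge. An acyclic orientation of the odd cycle is called almost bipartite if it contains exactly one directed $2$-path, i.e. exactly one pair of directed edges of the form $(u,v),(v,w)$ with $u,v,w\in V$. -}

module Defs where

open import Data.Nat using (ℕ; zero; suc; NonZero)
open import Data.Nat.DivMod using (_mod_)
open import Data.Bool using (Bool; true; false; if_then_else_)
open import Data.Fin using (Fin; toℕ) renaming (_<_ to _<ᶠ_)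
open import Data.Fin.Properties using (_≟_; all?; any?) renaming (_<?_ to _<ᶠ?_)
open import Data.Product using (Σ; ∃; _×_; _,_)
open import Data.List using (List; []; _∷_; map; concatMap; filter; length; allFin; cartesianProduct)
open import Data.Vec using (Vec; lookup) renaming ([] to []ᵛ; _∷_ to _∷ᵛ_)
open import Relation.Binary.PropositionalEquality using (_≡_)
open import Relation.Binary.Construct.Closure.Transitive using (TransClosure)
open import Relation.Nullary using (¬_; Dec)
open import Relation.Nullary.Decidable using (_×-dec_; _→-dec_)

-- The cycle C_m on m = suc k vertices: vertices Fin m, and for each
-- i : Fin m the edge e_i = {i, i+1 mod m}.

next : ∀ {k} → Fin (suc k) → Fin (suc k)
next {k} i = suc (toℕ i) mod (suc k)

-- An orientation of the edge set: o i = true  orients e_i as i → i+1,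
--                                  o i = false orients e_i as i+1 → i.
Orientation : ℕ → Set
Orientation k = Fin (suc k) → Bool

tail head : ∀ {k} → Orientation k → Fin (suc k) → Fin (suc k)
tail o i = if o i then i else next i
head o i = if o i then next i else i

Arc : ∀ {k} → Orientation k → Fin (suc k) → Fin (suc k) → Set
Arc o u v = ∃ λ i → tail o i ≡ u × head o i ≡ v

Acyclic : ∀ {k} → Orientation k → Set
Acyclic {k} o = ∀ (v : Fin (suc k)) → ¬ TransClosure (Arc o) v v

IsLinExt : ∀ {k} → Orientation k → (Fin (suc k) → Fin (suc k)) → Set
IsLinExt {k} o f =
  (∀ x y → f x ≡ f y → x ≡ y) ×
  (∀ y → ∃ λ x → f x ≡ y) ×
  (∀ i → f (tail o i) <ᶠ f (head o i))

isLinExt? : ∀ {k} (o : Orientation k) f → Dec (IsLinExt o f)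
isLinExt? o f =
  all? (λ x → all? (λ y → (f x ≟ f y) →-dec (x ≟ y)))
  ×-dec all? (λ y → any? (λ x → f x ≟ y))
  ×-dec all? (λ i → f (tail o i) <ᶠ? f (head o i))

-- All vectors of length m over Fin a (each function Fin m → Fin a is
-- lookup of exactly one of them).
allVecs : ∀ a m → List (Vec (Fin a) m)
allVecs a zero = []ᵛ ∷ []
allVecs a (suc m) = concatMap (λ x → map (x ∷ᵛ_) (allVecs a m)) (allFin a)

numLinExt : ∀ {k} → Orientation k → ℕ
numLinExt {k} o =
  length (filter (λ v → isLinExt? o (lookup v)) (allVecs (suc k) (suc k)))

num2Paths : ∀ {k} → Orientation k → ℕ
num2Paths {k} o =
  length (filter (λ p → head o (Data.Product.proj₁ p) ≟ tail o (Data.Product.proj₂ p))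
                 (cartesianProduct (allFin (suc k)) (allFin (suc k))))

AlmostBipartite : ∀ {k} → Orientation k → Set
AlmostBipartite o = num2Paths o ≡ 1

MaximizesLinExt : ∀ {k} → Orientation k → Set
MaximizesLinExt {k} o = ∀ (o' : Orientation k) → Acyclic o' → numLinExt o' Data.Nat.≤ numLinExt o

module Submission where

open import Defs
open import Data.Nat using (ℕ; _*_; _≤_)
open import Data.Product using (_×_)

open import Data.Bool using (Bool; true; false; not; if_then_else_; T)
import Data.Bool.Properties as Bool
open import Data.Fin using (Fin; zero; suc; toℕ; fromℕ<; opposite; punchOut) renaming (_<_ to _<ᶠ_)
open import Data.Fin.Properties using
  (_≟_; any?; toℕ-injective; toℕ<n; toℕ-fromℕ<; opposite-prop; opposite-involutive; injective⇒≤; punchOut-injective)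
open import Data.List using (List; []; _∷_; length; map; filter; allFin; cartesianProduct)
  renaming (lookup to lookupᴸ)
open import Data.List.Properties using (length-map; length-filter)
open import Data.List.Membership.Propositional using (_∈_)
open import Data.List.Membership.Propositional.Properties using
  (∈-lookup; ∈-map⁺; ∈-map⁻; ∈-concat⁺′; ∈-allFin; ∈-filter⁺; ∈-filter⁻; ∈-cartesianProduct⁺)
import Data.List.Membership.Setoid.Properties as Membershipₛ
import Data.List.Relation.Unary.All as All
import Data.List.Relation.Unary.All.Properties as All
import Data.List.Relation.Unary.AllPairs as AllPairs
open import Data.List.Relation.Unary.AllPairs using ([]; _∷_)
import Data.List.Relation.Unary.AllPairs.Properties as AllPairs
open import Data.List.Relation.Unary.All using ([])
open import Data.List.Relation.Unary.Any using (here; there; index)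
open import Data.List.Relation.Unary.Unique.Propositional using (Unique)
import Data.List.Relation.Unary.Unique.Propositional.Properties as Unique
import Data.Nat as ℕ
open import Data.Nat using (zero; suc; _+_; _∸_; _<_; _<ᵇ_; _≤?_; _<?_; z≤n; s≤s)
open import Data.Nat.DivMod
open import Data.Nat.Induction using (<-rec; <-wellFounded)
open import Data.Nat.Properties hiding (_≟_)
open import Data.Product using (∃; ∃₂; _,_; proj₁; proj₂)
open import Data.Sum using (_⊎_; inj₁; inj₂; [_,_]′)
open import Data.Vec using (Vec; lookup; tabulate) renaming ([] to []ᵛ; _∷_ to _∷ᵛ_)
open import Data.Vec.Properties using (lookup∘tabulate; tabulate∘lookup; tabulate-cong; ∷-injectiveˡ; ∷-injectiveʳ)
open import Function using (_∘_; id)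
open import Induction.WellFounded using (Acc; acc)
open import Relation.Binary.Construct.Closure.Transitive using (TransClosure; [_]; _∷_)
open import Relation.Binary.Definitions using (tri<; tri≈; tri>)
open import Relation.Binary.PropositionalEquality using
  (_≡_; _≢_; _≗_; refl; sym; trans; cong; subst; subst₂; setoid)
open import Relation.Nullary using (¬_; Dec; yes; no; contradiction)
open import Relation.Nullary.Decidable using (_×-dec_)
open import Relation.Unary using (Decidable)

-- Call edge i a repeat if edges i and i + 1 point the same way around, so that repeats are
-- directed 2-paths.  The cycle being odd, the gaps between consecutive repeats cannot all be
-- even, so either there is exactly one repeat or two consecutive ones lie at an odd distance
-- with strict alternation in between.  In the latter case, reversing the edges between them
-- strictly increases the number of linear extensions.  Indeed let b and b′ be the ends of the
-- reversed segment, with outer neighbours a < b and b′ < y.  For fixed values elsewhere and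
-- x < z, the outer constraints hold more easily for (b , b′) = (z , x) than for (x , z), those of
-- the segment more easily for (x , z) than for (z , x), and reflecting the segment swaps b and b′;
-- so reversal pairs favourable with favourable.  As the count is bounded, every orientation
-- is dominated by one with a single repeat, and these agree up to rotation and reversal.

private variable
  A B : Set
  k : ℕ

-- Counting linear extensions

lookup-injective : {xs : List A} → Unique xs → ∀ i j → lookupᴸ xs i ≡ lookupᴸ xs j → i ≡ j
lookup-injective (_ ∷ _)   zero    zero    _  = refl
lookup-injective (x∉ ∷ _)  zero    (suc j) eq = contradiction eq (All.lookup x∉ (∈-lookup j))
lookup-injective (x∉ ∷ _)  (suc i) zero    eq = contradiction (sym eq) (All.lookup x∉ (∈-lookup i))
lookup-injective (_ ∷ xs!) (suc i) (suc j) eq = cong suc (lookup-injective xs! i j eq)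

-- Pigeonhole: each position in `xs` goes to the position of the same element in `ys`, injectively
-- because `xs` has no repetitions.
length-mono-⊆ : {xs ys : List A} → Unique xs → (∀ {x} → x ∈ xs → x ∈ ys) → length xs ≤ length ys
length-mono-⊆ {A} {xs} {ys} xs! xs⊆ys = injective⇒≤ {f = λ i → index (xs⊆ys (∈-lookup i))}
  λ {i} {j} eq → lookup-injective xs! i j
    (Membershipₛ.index-injective (setoid A) (xs⊆ys (∈-lookup i)) (xs⊆ys (∈-lookup j)) eq)

-- Injectivity is asked only of members, since the maps used later are injective only between linear
-- extensions.
map-unique : (φ : A → B) {xs : List A} → (∀ {x y} → x ∈ xs → y ∈ xs → φ x ≡ φ y → x ≡ y) →
             Unique xs → Unique (map φ xs)
map-unique φ inj []        = []
map-unique φ inj (x∉ ∷ xs!) =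
  All.map⁺ (All.tabulate λ y∈ eq → All.lookup x∉ y∈ (inj (here refl) (there y∈) eq))
  ∷ map-unique φ (λ x∈ y∈ → inj (there x∈) (there y∈)) xs!

allVecs-unique : ∀ a m → Unique (allVecs a m)
allVecs-unique a zero    = [] ∷ []
allVecs-unique a (suc m) = Unique.concat⁺
  (All.map⁺ (All.tabulate λ _ → Unique.map⁺ ∷-injectiveʳ (allVecs-unique a m)))
  (AllPairs.map⁺ (AllPairs.map disjoint (Unique.allFin⁺ a)))
  where
  disjoint : ∀ {x y} → x ≢ y → ∀ {v} → ¬ (v ∈ map (x ∷ᵛ_) (allVecs a m) × v ∈ map (y ∷ᵛ_) (allVecs a m))
  disjoint x≢y (v∈ , v∈′) with _ , _ , eq ← ∈-map⁻ _ v∈ | _ , _ , eq′ ← ∈-map⁻ _ v∈′ =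
    x≢y (∷-injectiveˡ (trans (sym eq) eq′))

∈-allVecs : ∀ {a m} (v : Vec (Fin a) m) → v ∈ allVecs a m
∈-allVecs []ᵛ      = here refl
∈-allVecs (x ∷ᵛ v) = ∈-concat⁺′ (∈-map⁺ _ (∈-allVecs v)) (∈-map⁺ _ (∈-allFin x))

-- Keeps the two labels in cyclic order and lets the orientation bit pick the inequality, so that
-- rotations and reflections can be followed bit by bit.
Rel : Bool → ℕ → ℕ → Set
Rel true  x y = x < y
Rel false x y = y < x

Rel-not : ∀ b {x y} → Rel b x y → Rel (not b) y x
Rel-not true  x<y = x<y
Rel-not false y<x = y<x

record LinExt (o : Orientation k) (f : Fin (suc k) → Fin (suc k)) : Set where
  constructor linExt
  field
    injective : ∀ {x y} → f x ≡ f y → x ≡ y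
    respects  : ∀ i → Rel (o i) (toℕ (f i)) (toℕ (f (next i)))
open LinExt public

LinExt-cong : {o o′ : Orientation k} {f f′ : Fin (suc k) → Fin (suc k)} →
              o ≗ o′ → f ≗ f′ → LinExt o f → LinExt o′ f′
LinExt-cong {o = o} {f = f} o≗ f≗ l .injective {x} {y} eq = injective l (trans (f≗ x) (trans eq (sym (f≗ y))))
LinExt-cong o≗ f≗ l .respects i rewrite sym (o≗ i) | sym (f≗ i) | sym (f≗ (next i)) = respects l i

-- A missed value could be punched out, which would inject `suc k` elements into `k`.
injective⇒surjective : {f : Fin k → Fin k} → (∀ {x y} → f x ≡ f y → x ≡ y) → ∀ y → ∃ λ x → f x ≡ y
injective⇒surjective {suc k} {f} inj y with any? (λ x → f x ≟ y)
... | yes p = p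
... | no ∄x = contradiction
  (injective⇒≤ {f = λ x → punchOut (y≢f x)} (λ eq → inj (punchOut-injective (y≢f _) (y≢f _) eq))) 1+n≰n
  where
  y≢f : ∀ x → y ≢ f x
  y≢f x eq = ∄x (x , sym eq)

LinExt⇒IsLinExt : {o : Orientation k} {f : Fin (suc k) → Fin (suc k)} → LinExt o f → IsLinExt o f
LinExt⇒IsLinExt {o = o} {f} l =
  (λ _ _ → injective l) , injective⇒surjective (injective l) , λ i → edge i (o i) (respects l i)
  where
  edge : ∀ i b → Rel b (toℕ (f i)) (toℕ (f (next i))) → f (if b then i else next i) <ᶠ f (if b then next i else i)
  edge i true  r = r
  edge i false r = r

IsLinExt⇒LinExt : {o : Orientation k} {f : Fin (suc k) → Fin (suc k)} → IsLinExt o f → LinExt o f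
IsLinExt⇒LinExt {o = o} {f} (inj , _ , inc) = linExt (inj _ _) λ i → edge i (o i) (inc i)
  where
  edge : ∀ i b → f (if b then i else next i) <ᶠ f (if b then next i else i) → Rel b (toℕ (f i)) (toℕ (f (next i)))
  edge i true  r = r
  edge i false r = r

-- Labels strictly increase along directed paths. Later, acyclicity is proved by exhibiting a single
-- linear extension.
LinExt⇒Acyclic : {o : Orientation k} {f : Fin (suc k) → Fin (suc k)} → LinExt o f → Acyclic o
LinExt⇒Acyclic {o = o} {f} l v path = <-irrefl refl (increasing path)
  where
  arc : ∀ {u w} → Arc o u w → toℕ (f u) < toℕ (f w)
  arc (i , refl , refl) = proj₂ (proj₂ (LinExt⇒IsLinExt l)) i
  increasing : ∀ {u w} → TransClosure (Arc o) u w → toℕ (f u) < toℕ (f w)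
  increasing [ a ]   = arc a
  increasing (a ∷ p) = <-trans (arc a) (increasing p)

linExts : Orientation k → List (Vec (Fin (suc k)) (suc k))
linExts {k} o = filter (λ v → isLinExt? o (lookup v)) (allVecs (suc k) (suc k))

∈-linExts : {o : Orientation k} {f : Fin (suc k) → Fin (suc k)} → LinExt o f → tabulate f ∈ linExts o
∈-linExts {o = o} {f} l = ∈-filter⁺ _ (∈-allVecs (tabulate f))
  (LinExt⇒IsLinExt (LinExt-cong (λ _ → refl) (λ i → sym (lookup∘tabulate f i)) l))

linExts⇒LinExt : {o : Orientation k} → ∀ {v} → v ∈ linExts o → LinExt o (lookup v)
linExts⇒LinExt {o = o} v∈ = IsLinExt⇒LinExt (proj₂ (∈-filter⁻ (λ v → isLinExt? o (lookup v)) {xs = allVecs _ _} v∈))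

tabulate-injective : {f g : Fin k → A} → tabulate f ≡ tabulate g → f ≗ g
tabulate-injective {f = f} {g} eq i =
  trans (sym (lookup∘tabulate f i)) (trans (cong (λ v → lookup v i) eq) (lookup∘tabulate g i))

lookup-ext : {u v : Vec A k} → lookup u ≗ lookup v → u ≡ v
lookup-ext {u = u} {v} eq = trans (sym (tabulate∘lookup u)) (trans (tabulate-cong eq) (tabulate∘lookup v))

-- An injection between linear extensions is given up to pointwise equality; `tabulate` turns this
-- into equality of the vectors being counted.
module _ {o o′ : Orientation k} (φ : (Fin (suc k) → Fin (suc k)) → Fin (suc k) → Fin (suc k))
         (φ-linExt : ∀ {f} → LinExt o f → LinExt o′ (φ f))
         (φ-inj : ∀ {f g} → LinExt o f → LinExt o g → φ f ≗ φ g → f ≗ g) where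

  private
    Φ : Vec (Fin (suc k)) (suc k) → Vec (Fin (suc k)) (suc k)
    Φ v = tabulate (φ (lookup v))

    images : List (Vec (Fin (suc k)) (suc k))
    images = map Φ (linExts o)

    images-unique : Unique images
    images-unique = map-unique Φ
      (λ u∈ v∈ eq → lookup-ext (φ-inj (linExts⇒LinExt u∈) (linExts⇒LinExt v∈) (tabulate-injective eq)))
      (Unique.filter⁺ _ (allVecs-unique _ _))

    images⊆ : ∀ {v} → v ∈ images → v ∈ linExts o′
    images⊆ v∈ with _ , u∈ , refl ← ∈-map⁻ Φ v∈ = ∈-linExts (φ-linExt (linExts⇒LinExt u∈))

  numLinExt-≤ : numLinExt o ≤ numLinExt o′
  numLinExt-≤ = subst (_≤ _) (length-map Φ (linExts o)) (length-mono-⊆ images-unique images⊆)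

  -- A labelling `h` outside the image can be put in front of the list of images without creating a
  -- repetition, which gains one.
  numLinExt-< : ∀ {h} → LinExt o′ h → (∀ {f} → LinExt o f → ¬ (φ f ≗ h)) → numLinExt o < numLinExt o′
  numLinExt-< {h} h-linExt h∉ = subst (λ n → suc n ≤ _) (length-map Φ (linExts o))
    (length-mono-⊆ (All.tabulate new ∷ images-unique) λ where
      (here refl) → ∈-linExts h-linExt
      (there v∈)  → images⊆ v∈)
    where
    new : ∀ {v} → v ∈ images → tabulate h ≢ v
    new v∈ eq with _ , u∈ , refl ← ∈-map⁻ Φ v∈ = h∉ (linExts⇒LinExt u∈) (tabulate-injective (sym eq))

numLinExt-bounded : (o : Orientation k) → numLinExt o ≤ length (allVecs (suc k) (suc k))
numLinExt-bounded {k} o = length-filter _ (allVecs (suc k) (suc k))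

numLinExt-cong : {o o′ : Orientation k} → o ≗ o′ → numLinExt o ≡ numLinExt o′
numLinExt-cong o≗o′ = ≤-antisym
  (numLinExt-≤ id (LinExt-cong o≗o′ (λ _ → refl)) (λ _ _ eq → eq))
  (numLinExt-≤ id (LinExt-cong (λ i → sym (o≗o′ i)) (λ _ → refl)) (λ _ _ eq → eq))

-- Replacing every label by its `opposite` reverses all inequalities.
numLinExt-not : (o : Orientation k) → numLinExt (not ∘ o) ≡ numLinExt o
numLinExt-not o = ≤-antisym
  (≤-trans (not-≤ (not ∘ o)) (≤-reflexive (numLinExt-cong λ i → Bool.not-involutive (o i)))) (not-≤ o)
  where
  opposite-injective : ∀ {n} {i j : Fin n} → opposite i ≡ opposite j → i ≡ j
  opposite-injective {i = i} {j} eq =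
    trans (sym (opposite-involutive i)) (trans (cong opposite eq) (opposite-involutive j))
  opposite-< : ∀ {n} {i j : Fin n} → toℕ i < toℕ j → toℕ (opposite j) < toℕ (opposite i)
  opposite-< {suc n} {i} {j} i<j rewrite opposite-prop i | opposite-prop j = ∸-monoʳ-< i<j (≤-pred (toℕ<n j))
  opposite-Rel : ∀ b {n} {i j : Fin n} → Rel b (toℕ i) (toℕ j) → Rel (not b) (toℕ (opposite i)) (toℕ (opposite j))
  opposite-Rel true  = opposite-<
  opposite-Rel false = opposite-<
  not-≤ : (o : Orientation k) → numLinExt o ≤ numLinExt (not ∘ o)
  not-≤ o = numLinExt-≤ (opposite ∘_)
    (λ l → linExt (injective l ∘ opposite-injective) (λ i → opposite-Rel (o i) (respects l i)))
    (λ _ _ eq i → opposite-injective (eq i))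

-- Rotations of the cycle

pos : ℕ → Fin (suc k)
pos {k} j = j mod suc k

toℕ-pos : ∀ j → toℕ (pos {k} j) ≡ j % suc k
toℕ-pos {k} j = toℕ-fromℕ< (m%n<n j (suc k))

toℕ-pos-≤ : ∀ {j} → j ≤ k → toℕ (pos {k} j) ≡ j
toℕ-pos-≤ {j = j} j≤k = trans (toℕ-pos j) (m≤n⇒m%n≡m j≤k)

pos-cong-% : ∀ i j → i % suc k ≡ j % suc k → pos {k} i ≡ pos j
pos-cong-% i j eq = toℕ-injective (trans (toℕ-pos i) (trans eq (sym (toℕ-pos j))))

pos-toℕ : (i : Fin (suc k)) → pos (toℕ i) ≡ i
pos-toℕ i = toℕ-injective (toℕ-pos-≤ (≤-pred (toℕ<n i)))

pos-+ : ∀ i j → pos {k} (i + toℕ (pos {k} j)) ≡ pos (i + j)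
pos-+ {k} i j = pos-cong-% (i + toℕ (pos {k} j)) (i + j) (trans (%-distribˡ-+ i (toℕ (pos {k} j)) (suc k))
  (trans (cong (λ x → (i % suc k + x) % suc k) (trans (cong (_% suc k) (toℕ-pos j)) (m%n%n≡m%n j (suc k))))
         (sym (%-distribˡ-+ i j (suc k)))))

next-pos : ∀ j → next (pos {k} j) ≡ pos (suc j)
next-pos = pos-+ 1

pos-periodic : ∀ j t → pos {k} (j + t * suc k) ≡ pos j
pos-periodic {k} j t = pos-cong-% (j + t * suc k) j ([m+kn]%n≡m%n j t (suc k))

pos-length : pos {k} (suc k) ≡ pos 0
pos-length {k} = trans (cong pos (sym (+-identityʳ (suc k)))) (pos-periodic 0 1)

rot : ℕ → Fin (suc k) → Fin (suc k)
rot t i = pos (t + toℕ i)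

rot-pos : ∀ t j → rot {k} t (pos j) ≡ pos (t + j)
rot-pos = pos-+

rot-next : ∀ t (i : Fin (suc k)) → rot t (next i) ≡ next (rot t i)
rot-next t i = trans (rot-pos t (suc (toℕ i))) (trans (cong pos (+-suc t (toℕ i))) (sym (next-pos (t + toℕ i))))

rot-rot : ∀ s t (i : Fin (suc k)) → rot s (rot t i) ≡ pos (s + t + toℕ i)
rot-rot s t i = trans (rot-pos s (t + toℕ i)) (cong pos (sym (+-assoc s t (toℕ i))))

rot-cancel : ∀ s t n → s + t ≡ n * suc k → (i : Fin (suc k)) → rot s (rot t i) ≡ i
rot-cancel s t n eq i = trans (rot-rot s t i)
  (trans (cong pos (trans (cong (_+ toℕ i) eq) (+-comm _ (toℕ i)))) (trans (pos-periodic (toℕ i) n) (pos-toℕ i)))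

-- The two shifts add up to `t * suc k`, that is, `t` full turns; this gives an inverse without
-- subtraction.
rot-inverseˡ : ∀ t (i : Fin (suc k)) → rot (t * k) (rot t i) ≡ i
rot-inverseˡ {k} t = rot-cancel (t * k) t t (trans (+-comm (t * k) t) (sym (*-suc t k)))

rot-inverseʳ : ∀ t (i : Fin (suc k)) → rot t (rot (t * k) i) ≡ i
rot-inverseʳ {k} t = rot-cancel t (t * k) t (sym (*-suc t k))

LinExt-rot : ∀ {o : Orientation k} {f} t → LinExt o f → LinExt (o ∘ rot t) (f ∘ rot t)
LinExt-rot {o = o} {f} t l .injective {x} {y} eq =
  trans (sym (rot-inverseˡ t x)) (trans (cong (rot (t * _)) (injective l eq)) (rot-inverseˡ t y))
LinExt-rot {o = o} {f} t l .respects i rewrite rot-next t i = respects l (rot t i)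

numLinExt-rot : ∀ (o : Orientation k) t → numLinExt (o ∘ rot t) ≡ numLinExt o
numLinExt-rot {k} o t = ≤-antisym
  (≤-trans (rot-≤ (o ∘ rot t) (t * k)) (≤-reflexive (numLinExt-cong λ i → cong o (rot-inverseʳ t i))))
  (rot-≤ o t)
  where
  rot-≤ : ∀ (o : Orientation k) t → numLinExt o ≤ numLinExt (o ∘ rot t)
  rot-≤ o t = numLinExt-≤ (_∘ rot t) (LinExt-rot t)
    λ {f} {g} _ _ eq i → subst (λ j → f j ≡ g j) (rot-inverseʳ t i) (eq (rot (t * k) i))

-- Alternating words and parity

-- Also encodes parity: `alternate true j` is `true` for even `j` and `false` for odd `j`.
alternate : Bool → ℕ → Bool
alternate b zero    = b
alternate b (suc j) = not (alternate b j)

alternate-+ : ∀ b i j → alternate b (i + j) ≡ alternate (alternate b j) i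
alternate-+ b zero    j = refl
alternate-+ b (suc i) j = cong not (alternate-+ b i j)

alternate-not : ∀ b j → alternate (not b) j ≡ not (alternate b j)
alternate-not b zero    = refl
alternate-not b (suc j) = cong not (alternate-not b j)

alternate-false : ∀ j → alternate true j ≡ false → ∀ b → alternate b j ≡ not b
alternate-false j eq true  = eq
alternate-false j eq false = trans (alternate-not true j) (cong not eq)

alternate-double : ∀ n → alternate true (2 * n) ≡ true
alternate-double n rewrite +-identityʳ n | alternate-+ true n n with alternate true n in eq
... | true  = eq
... | false = alternate-false n eq false

≢⇒alternate : (w : ℕ → Bool) → ∀ n → (∀ j → j < n → w j ≢ w (suc j)) → ∀ j → j ≤ n → w j ≡ alternate (w 0) j
≢⇒alternate w n w≢ zero    _   = refl
≢⇒alternate w n w≢ (suc j) j<n =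
  trans (Bool.¬-not (w≢ j j<n ∘ sym)) (cong not (≢⇒alternate w n w≢ j (<⇒≤ j<n)))

-- Linear extensions with a prescribed maximum

-- Each vertex of the path 0 , … , n is placed below or above all later ones, as its edge demands.
peaked : (ℕ → Bool) → ℕ → ℕ → ℕ
peaked w zero    j       = 0
peaked w (suc n) zero    = if w 0 then 0 else suc n
peaked w (suc n) (suc j) = if w 0 then suc (peaked (w ∘ suc) n j) else peaked (w ∘ suc) n j

peaked-≤ : ∀ w n j → peaked w n j ≤ n
peaked-≤ w zero    j       = z≤n
peaked-≤ w (suc n) zero    with w 0
... | true  = z≤n
... | false = ≤-refl
peaked-≤ w (suc n) (suc j) with w 0
... | true  = s≤s (peaked-≤ _ n j)
... | false = m≤n⇒m≤1+n (peaked-≤ _ n j)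

peaked-injective : ∀ w n {i j} → i ≤ n → j ≤ n → peaked w n i ≡ peaked w n j → i ≡ j
peaked-injective w zero    z≤n z≤n eq = refl
peaked-injective w (suc n) {zero}  {zero}  _ _ eq = refl
peaked-injective w (suc n) {zero}  {suc j} _ _ eq with w 0
... | false = contradiction (subst (_≤ n) (sym eq) (peaked-≤ (w ∘ suc) n j)) 1+n≰n
peaked-injective w (suc n) {suc i} {zero}  _ _ eq with w 0
... | false = contradiction (subst (_≤ n) eq (peaked-≤ (w ∘ suc) n i)) 1+n≰n
peaked-injective w (suc n) {suc i} {suc j} (s≤s i≤n) (s≤s j≤n) eq with w 0
... | true  = cong suc (peaked-injective _ n i≤n j≤n (suc-injective eq))
... | false = cong suc (peaked-injective _ n i≤n j≤n eq)

peaked-Rel : ∀ w n {j} → j < n → Rel (w j) (peaked w n j) (peaked w n (suc j))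
peaked-Rel w (suc n) {zero}  _ with w 0
... | true  = s≤s z≤n
... | false = s≤s (peaked-≤ _ n 0)
peaked-Rel w (suc n) {suc j} (s≤s j<n) with w 0 | w (suc j) | peaked-Rel (w ∘ suc) n j<n
... | true  | true  | r = s≤s r
... | true  | false | r = s≤s r
... | false | _     | r = r

-- Both edges at vertex 0 point into it. `peaked` satisfies all edges of the path and gives vertex 0
-- the top label, which takes care of the closing edge.
peak-LinExt : (o : Orientation (suc k)) → o (pos 0) ≡ false → o (pos (suc k)) ≡ true →
              ∃ λ h → LinExt o h × toℕ (h (pos 0)) ≡ suc k
peak-LinExt {k} o down up = h , linExt inj resp , toℕ-h0
  where
  w : ℕ → Bool
  w j = o (pos j)
  h : Fin (suc (suc k)) → Fin (suc (suc k))
  h i = fromℕ< (s≤s (peaked-≤ w (suc k) (toℕ i)))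
  toℕ-h : ∀ i → toℕ (h i) ≡ peaked w (suc k) (toℕ i)
  toℕ-h i = toℕ-fromℕ< _
  toℕ-h0 : toℕ (h (pos 0)) ≡ suc k
  toℕ-h0 = trans (toℕ-h (pos 0)) (cong (if_then 0 else suc k) down)
  inj : ∀ {x y} → h x ≡ h y → x ≡ y
  inj {x} {y} eq = toℕ-injective (peaked-injective w (suc k) (≤-pred (toℕ<n x)) (≤-pred (toℕ<n y))
    (trans (sym (toℕ-h x)) (trans (cong toℕ eq) (toℕ-h y))))
  resp : ∀ i → Rel (o i) (toℕ (h i)) (toℕ (h (next i)))
  resp i with toℕ i ℕ.≟ suc k
  ... | no i≢ = subst₂ (λ b y → Rel b (toℕ (h i)) y) (cong o (pos-toℕ i))
                  (sym (trans (toℕ-h (next i)) (cong (peaked w (suc k)) (toℕ-pos-≤ i<))))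
                  (subst (λ x → Rel (w (toℕ i)) x (peaked w (suc k) (suc (toℕ i)))) (sym (toℕ-h i))
                    (peaked-Rel w (suc k) i<))
    where
    i< : toℕ i < suc k
    i< = ≤∧≢⇒< (≤-pred (toℕ<n i)) i≢
  -- The closing edge: its end `pos 0` has the top label, so by injectivity the other end has a
  -- smaller one.
  ... | yes i≡ = subst (λ b → Rel b (toℕ (h i)) (toℕ (h (next i)))) (sym o-i)
                   (subst (toℕ (h i) <_) (sym top) (≤∧≢⇒< (≤-pred (toℕ<n (h i))) λ eq →
                     contradiction
                       (trans (sym i≡) (cong toℕ (inj {i} {next i} (toℕ-injective (trans eq (sym top))))))
                       λ eq′ → contradiction (trans eq′ (cong toℕ next-i)) λ ()))
    where
    next-i : next i ≡ pos 0
    next-i = trans (cong (pos ∘ suc) i≡) pos-length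
    o-i : o i ≡ true
    o-i = trans (cong o (trans (sym (pos-toℕ i)) (cong pos i≡))) up
    top : toℕ (h (next i)) ≡ suc k
    top = trans (cong (toℕ ∘ h) next-i) toℕ-h0

-- Flipping an alternating segment

-- The reflection of the interval from `a` to `s - a`, fixing all else; the upper bound is tested as
-- `a + j ≤ s` to avoid truncated subtraction.
reverse : ℕ → ℕ → ℕ → ℕ
reverse a s j with a ≤? j | a + j ≤? s
... | yes _ | yes _ = s ∸ j
... | _     | _     = j

reverse-inside : ∀ {a s j} → a ≤ j → a + j ≤ s → reverse a s j ≡ s ∸ j
reverse-inside {a} {s} {j} a≤j a+j≤s with a ≤? j | a + j ≤? s
... | yes _ | yes _ = refl
... | yes _ | no ≰  = contradiction a+j≤s ≰
... | no ≰  | _     = contradiction a≤j ≰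

reverse-left : ∀ {a s j} → j < a → reverse a s j ≡ j
reverse-left {a} {s} {j} j<a with a ≤? j | a + j ≤? s
... | yes a≤j | _     = contradiction a≤j (<⇒≱ j<a)
... | no _    | yes _ = refl
... | no _    | no _  = refl

reverse-right : ∀ {a s j} → s < a + j → reverse a s j ≡ j
reverse-right {a} {s} {j} s<a+j with a ≤? j | a + j ≤? s
... | _     | yes p = contradiction p (<⇒≱ s<a+j)
... | yes _ | no _  = refl
... | no _  | no _  = refl

reverse-involutive : ∀ a s j → reverse a s (reverse a s j) ≡ j
reverse-involutive a s j = by-cases (a ≤? j) (a + j ≤? s)
  where
  outside : reverse a s j ≡ j → reverse a s (reverse a s j) ≡ j
  outside eq = trans (cong (reverse a s) eq) eq
  by-cases : Dec (a ≤ j) → Dec (a + j ≤ s) → reverse a s (reverse a s j) ≡ j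
  by-cases (no ≰)    _          = outside (reverse-left (≰⇒> ≰))
  by-cases (yes _)   (no ≰)     = outside (reverse-right (≰⇒> ≰))
  by-cases (yes a≤j) (yes a+j≤s) = trans (cong (reverse a s) (reverse-inside a≤j a+j≤s))
    (trans (reverse-inside (m+n≤o⇒m≤o∸n a a+j≤s)
             (≤-trans (+-monoˡ-≤ (s ∸ j) a≤j) (≤-reflexive (m+[n∸m]≡n j≤s))))
           (m∸[m∸n]≡n j≤s))
    where
    j≤s : j ≤ s
    j≤s = m+n≤o⇒n≤o a a+j≤s

reverse-≤ : ∀ {a s n j} → 1 ≤ a → s ≤ suc n → j ≤ n → reverse a s j ≤ n
reverse-≤ {a} {s} {n} {j} 1≤a s≤ j≤n with a ≤? j | a + j ≤? s
... | yes a≤j | yes _ = ∸-mono s≤ (≤-trans 1≤a a≤j)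
... | yes _   | no _  = j≤n
... | no _    | yes _ = j≤n
... | no _    | no _  = j≤n

reverseᶠ : ℕ → ℕ → Fin (suc k) → Fin (suc k)
reverseᶠ a s i = pos (reverse a s (toℕ i))

module _ {a s : ℕ} (1≤a : 1 ≤ a) (s≤ : s ≤ suc k) where

  -- The range includes `suc k`, the second name of vertex 0 and the far end of edge `k`. Under the
  -- bounds on `a` and `s` both names are fixed by the reflection.
  reverseᶠ-pos : ∀ {j} → j ≤ suc k → reverseᶠ {k} a s (pos j) ≡ pos (reverse a s j)
  reverseᶠ-pos {j} j≤ with m≤n⇒m<n∨m≡n j≤
  ... | inj₁ j<   = cong (pos ∘ reverse a s) (toℕ-pos-≤ (≤-pred j<))
  ... | inj₂ refl = trans (cong (reverseᶠ a s) (pos-length {k}))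
    (trans (cong pos (trans (cong (reverse a s) (toℕ-pos-≤ {k} z≤n)) (reverse-left 1≤a)))
    (trans (sym (pos-length {k})) (sym (cong pos
      (reverse-right {a} {s} {suc k} (≤-trans (s≤s s≤) (+-monoˡ-≤ (suc k) 1≤a)))))))

  reverseᶠ-involutive : ∀ i → reverseᶠ {k} a s (reverseᶠ a s i) ≡ i
  reverseᶠ-involutive i = trans (cong (pos ∘ reverse a s) (toℕ-pos-≤ (reverse-≤ 1≤a s≤ (≤-pred (toℕ<n i)))))
    (trans (cong pos (reverse-involutive a s (toℕ i))) (pos-toℕ i))

  reverseᶠ-injective : ∀ {i j} → reverseᶠ {k} a s i ≡ reverseᶠ a s j → i ≡ j
  reverseᶠ-injective {i} {j} eq =
    trans (sym (reverseᶠ-involutive i)) (trans (cong (reverseᶠ a s) eq) (reverseᶠ-involutive j))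

-- Edge j joins vertices j and j + 1.  Edges 0 and 1 and edges e - 1 and e form 2-paths with middle
-- vertices 1 and e; the edges 1 , … , e - 1 between them are flipped.
module Flip (o : Orientation k) (e : ℕ) (2≤e : 2 ≤ e) (e≤k : e ≤ k) (e-even : alternate true e ≡ true)
            (up-0 : o (pos 0) ≡ true) (up-e : o (pos e) ≡ true)
            (alternating : ∀ {j} → 0 < j → j < e → o (pos j) ≡ not (alternate true j)) where

  flipped : Orientation k
  flipped i = if toℕ i <ᵇ e then alternate true (toℕ i) else o i

  flipped-< : ∀ {j} → j < e → flipped (pos j) ≡ alternate true j
  flipped-< {j} j<e rewrite toℕ-pos-≤ (≤-trans (<⇒≤ j<e) e≤k) with j <ᵇ e | <⇒<ᵇ j<e
  ... | true | _ = refl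

  flipped-≥ : ∀ {j} → e ≤ j → j ≤ k → flipped (pos j) ≡ o (pos j)
  flipped-≥ {j} e≤j j≤k with toℕ (pos {k} j) <ᵇ e in eq
  ... | false = refl
  ... | true  = contradiction (subst (_< e) (toℕ-pos-≤ j≤k) (<ᵇ⇒< _ e (subst T (sym eq) _))) (≤⇒≯ e≤j)

  private
    s = suc e

    -- `ρ` reflects the vertices 1 , ... , e and exchanges the ends; `τ` reflects only 2 , ... , e -
    -- 1 and keeps the ends in place.
    ρ τ : Fin (suc k) → Fin (suc k)
    ρ = reverseᶠ 1 s
    τ = reverseᶠ 2 s

    ρ-pos : ∀ {j} → j ≤ suc k → ρ (pos j) ≡ pos (reverse 1 s j)
    ρ-pos = reverseᶠ-pos (s≤s z≤n) (s≤s e≤k)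
    τ-pos : ∀ {j} → j ≤ suc k → τ (pos j) ≡ pos (reverse 2 s j)
    τ-pos = reverseᶠ-pos (s≤s z≤n) (s≤s e≤k)

    module Labelling (f : Fin (suc k) → Fin (suc k)) where
      val : ℕ → ℕ
      val j = toℕ (f (pos j))

      -- The outer constraints, on edges 0 and `e`, as they read once the labels of vertices 1 and
      -- `e` are exchanged.
      Swappable : Set
      Swappable = val 0 < val e × val 1 < val s

      swappable? : Dec Swappable
      swappable? = (val 0 <? val e) ×-dec (val 1 <? val s)

      module _ (l : LinExt o f) where

        edge : ∀ j → Rel (o (pos j)) (val j) (val (suc j))
        edge j = subst (λ i → Rel (o (pos j)) (val j) (toℕ (f i))) (next-pos j) (respects l (pos j))

        up : ∀ {j} → o (pos j) ≡ true → val j < val (suc j)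
        up {j} eq = subst (λ b → Rel b (val j) (val (suc j))) eq (edge j)

        0<1 : val 0 < val 1
        0<1 = up up-0

        1<2 : val 1 < val 2
        1<2 = up (alternating (s≤s z≤n) 2≤e)

        e<s : val e < val s
        e<s = up up-e

        ends-distinct : val 1 ≢ val e
        ends-distinct eq = <⇒≢ 2≤e (trans (sym (toℕ-pos-≤ (≤-trans (<⇒≤ 2≤e) e≤k)))
          (trans (cong toℕ (injective l (toℕ-injective eq))) (toℕ-pos-≤ e≤k)))

        -- If `val 1 < val e`, then `val 0 < val 1` and `val e < val s` give both swapped
        -- constraints by transitivity.
        ¬swappable : ¬ Swappable → val e < val 1
        ¬swappable ¬sw with <-cmp (val 1) (val e)
        ... | tri< 1<e _ _ = contradiction (<-trans 0<1 1<e , <-trans 1<e e<s) ¬sw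
        ... | tri≈ _ eq _  = contradiction eq ends-distinct
        ... | tri> _ _ e<1 = e<1

        last-up : ∀ {j} → suc j ≡ e → val j < val e
        last-up {zero}  refl = contradiction 2≤e λ { (s≤s ()) }
        last-up {suc j} refl = up (trans (alternating (s≤s z≤n) ≤-refl) e-even)

        -- After reflection, edge `j` is edge `e - j` of `o` read backwards. As `e` is even, `e - j`
        -- has the parity of `j`, so the backward reading has the flipped bit. This serves both `ρ`
        -- and `τ`.
        mirrored : ∀ {a j} → a ≤ j → a + suc j ≤ s → 0 < j → 0 < a →
                   Rel (alternate true j) (val (reverse a s j)) (val (reverse a s (suc j)))
        mirrored {a} {j} a≤j a+j<s 0<j 0<a =
          subst₂ (λ x y → Rel (alternate true j) (val x) (val y))
            (sym (trans (reverse-inside a≤j (≤-trans (+-monoʳ-≤ a (n≤1+n j)) a+j<s)) (+-∸-assoc 1 (<⇒≤ j<e))))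
            (sym (reverse-inside (m≤n⇒m≤1+n a≤j) a+j<s))
            (subst (λ b → Rel b (val (suc (e ∸ j))) (val (e ∸ j))) bit (Rel-not _ (edge (e ∸ j))))
          where
          j<e : j < e
          j<e = ≤-pred (≤-trans (+-monoˡ-≤ (suc j) 0<a) a+j<s)
          bit : not (o (pos (e ∸ j))) ≡ alternate true j
          bit = trans (cong not (alternating (m<n⇒0<n∸m j<e) (∸-monoʳ-< 0<j (<⇒≤ j<e))))
            (trans (Bool.not-involutive _) same)
            where
            same : alternate true (e ∸ j) ≡ alternate true j
            same with alternate true j in eq
                    | trans (sym (alternate-+ true (e ∸ j) j))
                        (trans (cong (alternate true) (m∸n+n≡m (<⇒≤ j<e))) e-even)
            ... | true  | q = q
            ... | false | q = Bool.not-injective (trans (sym (alternate-not true (e ∸ j))) q)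

  open Labelling

  private
    transport : ∀ {f} a (1≤a : 1 ≤ a) → LinExt o f →
      (∀ j → j ≤ k → Rel (flipped (pos j)) (val f (reverse a s j)) (val f (reverse a s (suc j)))) →
      LinExt flipped (f ∘ reverseᶠ a s)
    transport a 1≤a l r .injective eq = reverseᶠ-injective 1≤a (s≤s e≤k) (injective l eq)
    transport {f} a 1≤a l r .respects i = subst
      (λ x → Rel (flipped x) (toℕ (f (reverseᶠ a s x))) (toℕ (f (reverseᶠ a s (next x))))) (pos-toℕ i)
      (subst₂ (λ x y → Rel (flipped (pos j)) (toℕ (f x)) (toℕ (f y)))
        (sym (reverseᶠ-pos 1≤a (s≤s e≤k) (m≤n⇒m≤1+n j≤k)))
        (sym (trans (cong (reverseᶠ a s) (next-pos j)) (reverseᶠ-pos 1≤a (s≤s e≤k) (s≤s j≤k))))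
        (r j j≤k))
      where
      j : ℕ
      j = toℕ i
      j≤k : j ≤ k
      j≤k = ≤-pred (toℕ<n i)

    module _ {f} (l : LinExt o f) where

      beyond : ∀ {a j} → 1 ≤ a → e < j → j ≤ k →
               Rel (flipped (pos j)) (val f (reverse a s j)) (val f (reverse a s (suc j)))
      beyond {a} {j} 1≤a e<j j≤k
        rewrite reverse-right {a} {s} (+-mono-≤ 1≤a e<j)
              | reverse-right {a} {s} {suc j} (+-mono-≤ 1≤a (≤-trans e<j (n≤1+n j)))
              | flipped-≥ (<⇒≤ e<j) j≤k = edge f l j

      ρ-linExt : Swappable f → LinExt flipped (f ∘ ρ)
      ρ-linExt (0<e , 1<s) = transport 1 (s≤s z≤n) l relation
        where
        relation : ∀ j → j ≤ k → Rel (flipped (pos j)) (val f (reverse 1 s j)) (val f (reverse 1 s (suc j)))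
        relation j j≤k with <-cmp j e
        relation zero j≤k | tri< 0<e′ _ _
          rewrite flipped-< 0<e′ | reverse-left {1} {s} (s≤s z≤n)
                | reverse-inside {1} {s} {1} ≤-refl (s≤s 0<e′) = 0<e
        relation (suc j) j≤k | tri< j<e _ _
          rewrite flipped-< j<e = mirrored f l {1} (s≤s z≤n) (s≤s j<e) (s≤s z≤n) (s≤s z≤n)
        ... | tri≈ _ refl _
          rewrite flipped-≥ ≤-refl j≤k | up-e | reverse-inside {1} {s} {e} (<⇒≤ 2≤e) ≤-refl
                | reverse-right {1} {s} {s} ≤-refl | m+n∸n≡m 1 e = 1<s
        ... | tri> _ _ e<j = beyond (s≤s z≤n) e<j j≤k

      τ-linExt : val f e < val f 1 → LinExt flipped (f ∘ τ)
      τ-linExt e<1 = transport 2 (s≤s z≤n) l relation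
        where
        2<e : 2 < e
        -- If `e` were 2, edge 1 would demand `val 1 < val e`.
        2<e = ≤∧≢⇒< 2≤e λ { refl → <-asym e<1 (1<2 f l) }
        relation : ∀ j → j ≤ k → Rel (flipped (pos j)) (val f (reverse 2 s j)) (val f (reverse 2 s (suc j)))
        relation j j≤k with <-cmp j e
        relation 0 j≤k | tri< 0<e′ _ _
          rewrite flipped-< 0<e′ | reverse-left {2} {s} {0} (s≤s z≤n) | reverse-left {2} {s} {1} ≤-refl = 0<1 f l
        -- Vertex 1 keeps its label while vertex 2 receives that of `e - 1`: the chain is
        -- `val (e - 1) < val e < val 1`.
        relation 1 j≤k | tri< 1<e _ _
          rewrite flipped-< 1<e | reverse-left {2} {s} {1} ≤-refl | reverse-inside {2} {s} {2} ≤-refl (s≤s 2<e) =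
          <-trans (last-up f l (m+[n∸m]≡n (<⇒≤ 1<e))) e<1
        relation (suc (suc j)) j≤k | tri< j<e _ _ with m≤n⇒m<n∨m≡n j<e
        ... | inj₁ j+1<e rewrite flipped-< j<e =
          mirrored f l {2} (s≤s (s≤s z≤n)) (s≤s j+1<e) (s≤s z≤n) (s≤s z≤n)
        -- Symmetrically, vertex `e - 1` receives the label of 2: the chain is
        -- `val e < val 1 < val 2`.
        ... | inj₂ refl
          rewrite flipped-< j<e | Bool.not-injective {alternate true (suc (suc j))} {false} e-even
                | reverse-inside {2} {s} {suc (suc j)} (s≤s (s≤s z≤n)) ≤-refl
                | reverse-right {2} {s} {e} ≤-refl
                | m+n∸n≡m 2 j = <-trans e<1 (1<2 f l)
        relation j j≤k | tri≈ _ refl _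
          rewrite flipped-≥ ≤-refl j≤k | up-e
                | reverse-right {2} {s} {e} ≤-refl | reverse-right {2} {s} {s} (s≤s (n≤1+n s)) = e<s f l
        relation j j≤k | tri> _ _ e<j = beyond (s≤s z≤n) e<j j≤k

    φ : (Fin (suc k) → Fin (suc k)) → Fin (suc k) → Fin (suc k)
    φ f with swappable? f
    ... | yes _ = f ∘ ρ
    ... | no _  = f ∘ τ

    φ-linExt : ∀ {f} → LinExt o f → LinExt flipped (φ f)
    φ-linExt {f} l with swappable? f
    ... | yes sw = ρ-linExt l sw
    ... | no ¬sw = τ-linExt l (¬swappable f l ¬sw)

    -- φ is injective since f ∘ ρ ≗ g ∘ τ makes g equal to f with the values at 1 and e exchanged, for
    -- which the constraints on f say exactly that g ∘ ρ would have been admissible too.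
    ρ≗τ⇒swappable : ∀ {f g} → LinExt o f → f ∘ ρ ≗ g ∘ τ → Swappable g
    ρ≗τ⇒swappable {f} {g} l eq = subst₂ _<_ at-0 at-1 (0<1 f l) , subst₂ _<_ at-e at-s (e<s f l)
      where
      agree : ∀ {x y} j → j ≤ suc k → reverse 1 s j ≡ x → reverse 2 s j ≡ y → val f x ≡ val g y
      agree j j≤ refl refl = trans (cong (toℕ ∘ f) (sym (ρ-pos j≤)))
        (trans (cong toℕ (eq (pos j))) (cong (toℕ ∘ g) (τ-pos j≤)))
      1≤e = <⇒≤ 2≤e
      at-0 : val f 0 ≡ val g 0
      at-0 = agree 0 z≤n (reverse-left {1} {s} (s≤s z≤n)) (reverse-left {2} {s} (s≤s z≤n))
      at-1 : val f 1 ≡ val g e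
      at-1 = agree e (m≤n⇒m≤1+n e≤k)
        (trans (reverse-inside {1} 1≤e ≤-refl) (m+n∸n≡m 1 e)) (reverse-right {2} {s} ≤-refl)
      at-e : val f e ≡ val g 1
      at-e = agree 1 (s≤s z≤n) (reverse-inside {1} ≤-refl (s≤s 1≤e)) (reverse-left {2} {s} ≤-refl)
      at-s : val f s ≡ val g s
      at-s = agree s (s≤s e≤k) (reverse-right {1} {s} ≤-refl) (reverse-right {2} {s} (s≤s (n≤1+n s)))

    cancel : ∀ {a} {f g : Fin (suc k) → Fin (suc k)} → 1 ≤ a → f ∘ reverseᶠ a s ≗ g ∘ reverseᶠ a s → f ≗ g
    cancel {a} {f} {g} 1≤a eq i =
      subst (λ x → f x ≡ g x) (reverseᶠ-involutive 1≤a (s≤s e≤k) i) (eq (reverseᶠ a s i))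

    φ-injective : ∀ {f g} → LinExt o f → LinExt o g → φ f ≗ φ g → f ≗ g
    φ-injective {f} {g} lf lg eq with swappable? f | swappable? g
    ... | yes _  | yes _  = cancel (s≤s z≤n) eq
    ... | yes _  | no ¬sw = contradiction (ρ≗τ⇒swappable {g = g} lf eq) ¬sw
    ... | no ¬sw | yes _  = contradiction (ρ≗τ⇒swappable {g = f} lg (sym ∘ eq)) ¬sw
    ... | no _   | no _   = cancel (s≤s z≤n) eq

    -- Vertex 1 receives either `val e`, which is below `val s`, or `val 1`, which is below `val 2`;
    -- neither is the top label.
    φ-not-peaked : ∀ {f} → LinExt o f → toℕ (φ f (pos 1)) ≢ k
    φ-not-peaked {f} l eq with swappable? f
    ... | yes _ = <⇒≱ (e<s f l) (≤-trans (≤-pred (toℕ<n (f (pos s)))) (≤-reflexive (sym (trans (cong (toℕ ∘ f)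
                    (sym (trans (ρ-pos (s≤s z≤n)) (cong pos (reverse-inside {1} ≤-refl (s≤s (<⇒≤ 2≤e))))))) eq))))
    ... | no _  = <⇒≱ (1<2 f l) (≤-trans (≤-pred (toℕ<n (f (pos 2)))) (≤-reflexive (sym (trans (cong (toℕ ∘ f)
                    (sym (trans (τ-pos (s≤s z≤n)) (cong pos (reverse-left {2} {s} ≤-refl))))) eq))))

    -- In `flipped`, edges 0 and 1 both point into vertex 1. Rotating by 1 brings this sink to
    -- vertex 0, where `peak-LinExt` applies. The result is the labelling that `φ` misses.
    peaked-at-1 : ∃ λ h → LinExt flipped h × toℕ (h (pos 1)) ≡ k
    peaked-at-1 = rotated k refl
      where
      rotated : ∀ k′ → k ≡ k′ → ∃ λ h → LinExt flipped h × toℕ (h (pos 1)) ≡ k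
      rotated zero    refl = contradiction (≤-trans 2≤e e≤k) λ ()
      rotated (suc k′) refl with peak-LinExt (flipped ∘ rot 1)
                (trans (cong flipped (rot-pos 1 0)) (flipped-< 2≤e))
                (trans (cong flipped (trans (rot-pos 1 k) pos-length)) (flipped-< (<⇒≤ 2≤e)))
      ... | h , l , top = h ∘ rot (1 * k)
        , LinExt-cong (λ i → cong flipped (rot-inverseʳ 1 i)) (λ _ → refl) (LinExt-rot (1 * k) l)
        , trans (cong (toℕ ∘ h) (trans (cong (rot (1 * k)) (sym (rot-pos 1 0))) (rot-inverseˡ 1 (pos 0)))) top

  flipped-acyclic : Acyclic flipped
  flipped-acyclic = LinExt⇒Acyclic (proj₁ (proj₂ peaked-at-1))

  numLinExt-flipped : numLinExt o < numLinExt flipped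
  numLinExt-flipped with h , l , top ← peaked-at-1 =
    numLinExt-< φ φ-linExt φ-injective l λ lf eq → φ-not-peaked lf (trans (cong toℕ (eq (pos 1))) top)

-- Repeats

OddGap : (ℕ → Set) → ℕ → ℕ → Set
OddGap P l D = ∃₂ λ i d → l ≤ i × i + d ≤ l + D × alternate true d ≡ false × P i × P (i + d) ×
                 (∀ j → 0 < j → j < d → ¬ P (i + j))

-- An element of `P` strictly inside splits the odd length into two parts, exactly one of them odd;
-- the recursion continues there until nothing lies inside.
oddGap : {P : ℕ → Set} → Decidable P → ∀ D l → alternate true D ≡ false → P l → P (l + D) → OddGap P l D
oddGap {P} P? = <-rec _ go
  where
  go : ∀ D → (∀ {D′} → D′ < D → ∀ l → alternate true D′ ≡ false → P l → P (l + D′) → OddGap P l D′) →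
       ∀ l → alternate true D ≡ false → P l → P (l + D) → OddGap P l D
  go (suc D) rec l odd Pl Pl+D with anyUpTo? (λ j → P? (l + suc j)) D
  ... | no ∄ = l , suc D , ≤-refl , ≤-refl , odd , Pl , Pl+D ,
               λ { (suc j) _ (s≤s j<D) Pj → ∄ (j , j<D , Pj) }
  ... | yes (j , j<D , Pj) with alternate true (suc j) in eq
  ...   | false = let (i , d , l≤i , i+d≤ , rest) = rec (s≤s j<D) l eq Pl Pj
                  in i , d , l≤i , ≤-trans i+d≤ (+-monoʳ-≤ l (s≤s (<⇒≤ j<D))) , rest
  ...   | true  = let (i , d , l+j≤i , i+d≤ , rest) =
                        rec (s≤s (m∸n≤m D j)) (l + suc j) odd′ Pj (subst P (sym end) Pl+D)
                  in i , d , ≤-trans (m≤m+n l (suc j)) l+j≤i , ≤-trans i+d≤ (≤-reflexive end) , rest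
    where
    end : l + suc j + (D ∸ j) ≡ l + suc D
    end = trans (+-assoc l (suc j) (D ∸ j)) (cong ((l +_) ∘ suc) (m+[n∸m]≡n (<⇒≤ j<D)))
    odd′ : alternate true (D ∸ j) ≡ false
    odd′ = trans (cong (λ b → alternate b (D ∸ j)) (sym eq))
      (trans (sym (alternate-+ true (D ∸ j) (suc j)))
      (trans (cong (alternate true) (trans (+-suc (D ∸ j) j) (cong suc (m∸n+n≡m (<⇒≤ j<D))))) odd))

-- Says that next i is the middle vertex of a directed 2-path.
Repeat : Orientation k → Fin (suc k) → Set
Repeat o i = o i ≡ o (next i)

UniqueRepeat : Orientation k → Set
UniqueRepeat o = ∃ λ i → Repeat o i × (∀ {j} → Repeat o j → j ≡ i)

Improvable : Orientation k → Set
Improvable {k} o = ∃ λ (o′ : Orientation k) → Acyclic o′ × numLinExt o < numLinExt o′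

repeat-rot : (o : Orientation k) → ∀ l j → Repeat o (pos (l + j)) → Repeat (o ∘ rot l) (pos j)
repeat-rot o l j r = trans (cong o (rot-pos l j)) (trans r
  (cong o (trans (cong next (sym (rot-pos l j))) (sym (rot-next l (pos j))))))

rot-repeat : (o : Orientation k) → ∀ l j → Repeat (o ∘ rot l) (pos j) → Repeat o (pos (l + j))
rot-repeat o l j r = trans (cong o (sym (rot-pos l j))) (trans r
  (cong o (trans (rot-next l (pos j)) (cong next (rot-pos l j)))))

-- Improving orientations with several repeats

module _ (k-even : alternate true k ≡ true) where

  flip-improves : (o : Orientation k) → ∀ d → alternate true d ≡ false → suc d ≤ k →
    o (pos 0) ≡ true → Repeat o (pos 0) → Repeat o (pos d) →
    (∀ j → 0 < j → j < d → ¬ Repeat o (pos j)) → Improvable o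
  flip-improves o (suc d) odd d<k up repeat-0 repeat-d ¬repeat =
    Fl.flipped , Fl.flipped-acyclic , Fl.numLinExt-flipped
    where
    word : ∀ j → j ≤ d → o (pos (suc j)) ≡ alternate true j
    word j j≤d = trans (≢⇒alternate (o ∘ pos ∘ suc) d
        (λ i i<d eq → ¬repeat (suc i) (s≤s z≤n) (s≤s i<d) (trans eq (cong o (sym (next-pos (suc i))))))
        j j≤d)
      (cong (λ b → alternate b j) (trans (cong o (sym (next-pos 0))) (trans (sym repeat-0) up)))
    up-end : o (pos (suc (suc d))) ≡ true
    up-end = trans (cong o (sym (next-pos (suc d))))
      (trans (sym repeat-d) (trans (word d ≤-refl) (Bool.not-injective odd)))
    alternating : ∀ {j} → 0 < j → j < suc (suc d) → o (pos j) ≡ not (alternate true j)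
    alternating {suc j} _ (s≤s (s≤s j≤d)) = trans (word j j≤d) (sym (Bool.not-involutive _))
    -- A repeat at index `i` has middle vertex `i + 1`, so `e` is one more than the gap between the
    -- repeats, and an odd gap makes `e` even.
    module Fl = Flip o (suc (suc d)) (s≤s (s≤s z≤n)) d<k (cong not odd) up up-end alternating

  -- Rotation moves the gap to index 0, and reversing all edges if needed makes its first edge point
  -- up; both preserve the number of linear extensions.
  gap-improves : (o : Orientation k) → ∀ l d → alternate true d ≡ false → suc d ≤ k →
    Repeat o (pos l) → Repeat o (pos (l + d)) → (∀ j → 0 < j → j < d → ¬ Repeat o (pos (l + j))) → Improvable o
  gap-improves o l d odd d<k repeat-l repeat-l+d ¬repeat = oriented (o (pos l)) refl
    where
    õ : Orientation k
    õ = o ∘ rot l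
    õ-0 : õ (pos 0) ≡ o (pos l)
    õ-0 = cong o (trans (rot-pos l 0) (cong pos (+-identityʳ l)))
    repeat-0 : Repeat õ (pos 0)
    repeat-0 = repeat-rot o l 0 (subst (Repeat o ∘ pos) (sym (+-identityʳ l)) repeat-l)
    oriented : ∀ b → o (pos l) ≡ b → Improvable o
    oriented true eq =
      let (o′ , acyclic , lt) = flip-improves õ d odd d<k (trans õ-0 eq) repeat-0 (repeat-rot o l d repeat-l+d)
                                  (λ j 0<j j<d → ¬repeat j 0<j j<d ∘ rot-repeat o l j)
      in o′ , acyclic , subst (_< numLinExt o′) (numLinExt-rot o l) lt
    oriented false eq =
      let (o′ , acyclic , lt) = flip-improves (not ∘ õ) d odd d<k (cong not (trans õ-0 eq)) (cong not repeat-0)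
                                  (cong not (repeat-rot o l d repeat-l+d))
                                  (λ j 0<j j<d → ¬repeat j 0<j j<d ∘ rot-repeat o l j ∘ Bool.not-injective)
      in o′ , acyclic , subst (_< numLinExt o′) (trans (numLinExt-not õ) (numLinExt-rot o l)) lt

  -- Without repeats the bits would alternate all the way round, and after an odd number of steps
  -- the first edge would get the opposite bit.
  exists-repeat : (o : Orientation k) → ∃ λ l → Repeat o (pos l)
  exists-repeat o with anyUpTo? (λ j → o (pos j) Bool.≟ o (next (pos j))) (suc k)
  ... | yes (l , _ , r) = l , r
  ... | no ∄ = contradiction
    (trans (sym (≢⇒alternate (o ∘ pos) (suc k)
                  (λ j j<m eq → ∄ (j , j<m , trans eq (cong o (sym (next-pos j))))) (suc k) ≤-refl))
           (cong o (pos-length {k})))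
    (λ eq → Bool.not-¬ {o (pos 0)} refl (trans (sym eq) (alternate-false (suc k) (cong not k-even) (o (pos 0)))))

  unique-or-improvable : (o : Orientation k) → UniqueRepeat o ⊎ Improvable o
  unique-or-improvable o with l₀ , r₀ ← exists-repeat o
    -- One full turn, of odd length `suc k`, leads from the repeat at `l₀` back to itself.
    with i , d , l₀≤i , i+d≤ , odd , r , r′ , ¬r ←
         oddGap (λ j → o (pos j) Bool.≟ o (next (pos j))) (suc k) l₀ (cong not k-even) r₀
           (subst (Repeat o) (sym (trans (cong (pos ∘ (l₀ +_)) (sym (*-identityˡ (suc k)))) (pos-periodic l₀ 1))) r₀)
    with <-cmp d k
  ... | tri< d<k _ _ = inj₂ (gap-improves o i d odd d<k r r′ ¬r)
  ... | tri≈ _ refl _ = contradiction (trans (sym odd) k-even) λ ()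
  -- The gap spans the whole cycle: every vertex is `pos (i + t)` for some `t < d`, and only `t = 0`
  -- can be a repeat.
  ... | tri> _ _ k<d = inj₁ (pos i , r , unique)
    where
    unique : ∀ {j} → Repeat o j → j ≡ pos i
    unique {j} rj = from (toℕ (rot {k} (i * k) j)) refl
      where
      from : ∀ t → toℕ (rot {k} (i * k) j) ≡ t → j ≡ pos i
      from t eq = at t (≤-trans (s≤s (≤-pred (subst (_< suc k) eq (toℕ<n (rot {k} (i * k) j))))) k<d)
                    (trans (sym (rot-inverseʳ i j)) (cong (pos ∘ (i +_)) eq))
        where
        at : ∀ t → t < d → j ≡ pos (i + t) → j ≡ pos i
        at zero    _   j≡ = trans j≡ (cong pos (+-identityʳ i))
        at (suc t) t<d j≡ = contradiction (subst (Repeat o) j≡ rj) (¬r (suc t) (s≤s z≤n) t<d)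

-- Orientations with a single repeat

zigzag : Orientation k
zigzag i = alternate true (toℕ i)

unique⇒zigzag : (o : Orientation k) → UniqueRepeat o → numLinExt o ≡ numLinExt (zigzag {k})
unique⇒zigzag {k} o (i , _ , unique) = oriented (õ (pos 0)) refl
  where
  t : ℕ
  -- This shift moves the repeat to the last index `k`, so the bits alternate from index 0 through
  -- `k`.
  t = suc (toℕ i)
  õ : Orientation k
  õ = o ∘ rot t
  no-repeat : ∀ j → j < k → õ (pos j) ≢ õ (pos (suc j))
  no-repeat j j<k eq = contradiction
    (cong toℕ j≡k)
    (<⇒≢ (subst₂ _<_ (sym (toℕ-pos-≤ (<⇒≤ j<k))) (sym (toℕ-pos-≤ ≤-refl)) j<k))
    where
    rotated : rot t (pos j) ≡ rot t (pos k)
    rotated = trans (unique (trans eq (cong o (trans (cong (rot t) (sym (next-pos j))) (rot-next t (pos j))))))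
      (sym (trans (rot-pos t k)
        (trans (cong pos (trans (sym (+-suc (toℕ i) k)) (cong (toℕ i +_) (sym (*-identityˡ (suc k))))))
        (trans (pos-periodic (toℕ i) 1) (pos-toℕ i)))))
    j≡k : pos {k} j ≡ pos k
    j≡k = trans (sym (rot-inverseˡ t (pos j))) (trans (cong (rot (t * k)) rotated) (rot-inverseˡ t (pos k)))
  word : ∀ x → õ x ≡ alternate (õ (pos 0)) (toℕ x)
  word x = trans (cong õ (sym (pos-toℕ x))) (≢⇒alternate (õ ∘ pos) k no-repeat (toℕ x) (≤-pred (toℕ<n x)))
  oriented : ∀ b → õ (pos 0) ≡ b → numLinExt o ≡ numLinExt (zigzag {k})
  oriented true eq = trans (sym (numLinExt-rot o t))
    (numLinExt-cong λ x → trans (word x) (cong (λ b → alternate b (toℕ x)) eq))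
  oriented false eq = trans (sym (numLinExt-rot o t)) (trans (sym (numLinExt-not õ))
    (numLinExt-cong λ x → trans
      (cong not (trans (word x) (trans (cong (λ b → alternate b (toℕ x)) eq) (alternate-not true (toℕ x)))))
      (Bool.not-involutive _)))

-- Improve until a single repeat is left; the distance of the count to its upper bound decreases at
-- each improvement.
zigzag-maximal : alternate true k ≡ true → (o : Orientation k) → numLinExt o ≤ numLinExt (zigzag {k})
zigzag-maximal {k} k-even o = go o (<-wellFounded (bound ∸ numLinExt o))
  where
  bound = length (allVecs (suc k) (suc k))
  go : ∀ o → Acc _<_ (bound ∸ numLinExt o) → numLinExt o ≤ numLinExt (zigzag {k})
  go o (acc rec) = [ ≤-reflexive ∘ unique⇒zigzag o
                   , (λ (o′ , _ , lt) → ≤-trans (<⇒≤ lt) (go o′ (rec (∸-monoʳ-< lt (numLinExt-bounded o′)))))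
                   ]′ (unique-or-improvable k-even o)

-- Repeats as directed 2-paths

next-injective : ∀ {i j : Fin (suc k)} → next i ≡ next j → i ≡ j
-- `next` is `rot 1` by computation.
next-injective {k} {i} {j} eq = trans (sym (rot-inverseˡ 1 i)) (trans (cong (rot (1 * k)) eq) (rot-inverseˡ 1 j))

module _ (o : Orientation k) where

  -- The two edges at `next i`, in the order in which a directed path with bit `b` traverses them.
  pathOf : Bool → Fin (suc k) → Fin (suc k) × Fin (suc k)
  pathOf b i = if b then (i , next i) else (next i , i)

  Composable : Fin (suc k) × Fin (suc k) → Set
  Composable (a , b) = head o a ≡ tail o b

  composable? : Decidable Composable
  composable? (a , b) = head o a ≟ tail o b

  edgePairs : List (Fin (suc k) × Fin (suc k))
  edgePairs = cartesianProduct (allFin (suc k)) (allFin (suc k))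

  paths : List (Fin (suc k) × Fin (suc k))
  paths = filter composable? edgePairs

  paths-unique : Unique paths
  paths-unique = Unique.filter⁺ composable?
    (Unique.cartesianProduct⁺ (Unique.allFin⁺ (suc k)) (Unique.allFin⁺ (suc k)))

  pathOf∈paths : ∀ {i} → Repeat o i → pathOf (o i) i ∈ paths
  pathOf∈paths {i} r =
    ∈-filter⁺ composable? (∈-cartesianProduct⁺ (∈-allFin _) (∈-allFin _)) (by-cases (o i) refl (sym r))
    where
    by-cases : ∀ b → o i ≡ b → o (next i) ≡ b → Composable (pathOf b i)
    by-cases true  p q rewrite p | q = refl
    by-cases false p q rewrite p | q = refl

  -- The edges at a repeat share one bit, so repeats with different bits cannot give the same pair;
  -- for equal bits a component of the pair is the index.
  pathOf-injective : ∀ {i j} → Repeat o i → pathOf (o i) i ≡ pathOf (o j) j → i ≡ j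
  pathOf-injective {i} {j} r = by-cases (o i) (o j) refl refl
    where
    by-cases : ∀ b c → o i ≡ b → o j ≡ c → pathOf b i ≡ pathOf c j → i ≡ j
    by-cases true  true  _  _  eq = cong proj₁ eq
    by-cases false false _  _  eq = cong proj₂ eq
    by-cases true  false oi oj eq = contradiction (trans (sym oi) (trans r (trans (cong (o ∘ proj₂) eq) oj))) λ ()
    by-cases false true  oi oj eq = contradiction (trans (sym oi) (trans r (trans (cong (o ∘ proj₁) eq) oj))) λ ()

  -- Composable edges with opposite bits would coincide, which is absurd; with equal bits one edge
  -- is the successor of the other.
  ∈paths⇒pathOf : ∀ {p} → p ∈ paths → ∃ λ i → Repeat o i × p ≡ pathOf (o i) i
  ∈paths⇒pathOf {a , b} p∈ =
    by-cases (o a) (o b) refl refl (proj₂ (∈-filter⁻ composable? {xs = edgePairs} p∈))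
    where
    by-cases : ∀ x y → o a ≡ x → o b ≡ y → (if x then next a else a) ≡ (if y then b else next b) →
               ∃ λ i → Repeat o i × (a , b) ≡ pathOf (o i) i
    by-cases true  true  oa ob refl = a , trans oa (sym ob) , cong (λ x → pathOf x a) (sym oa)
    by-cases false false oa ob refl = b , trans ob (sym oa) , cong (λ x → pathOf x b) (sym ob)
    by-cases true  false oa ob eq   = contradiction (trans (sym oa) (trans (cong o (next-injective eq)) ob)) λ ()
    by-cases false true  oa ob refl = contradiction (trans (sym oa) ob) λ ()

  unique⇒almostBipartite : UniqueRepeat o → AlmostBipartite o
  unique⇒almostBipartite (i , r , unique) = ≤-antisym
    (length-mono-⊆ {ys = path ∷ []} paths-unique λ p∈ →
      let (j , rj , eq) = ∈paths⇒pathOf p∈ in here (trans eq (cong (λ j → pathOf (o j) j) (unique rj))))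
    (length-mono-⊆ {xs = path ∷ []} {paths} ([] ∷ []) λ { (here refl) → pathOf∈paths r })
    where
    path : Fin (suc k) × Fin (suc k)
    path = pathOf (o i) i

  almostBipartite⇒unique : AlmostBipartite o → UniqueRepeat o
  almostBipartite⇒unique = from paths refl
    where
    from : ∀ ps → paths ≡ ps → length ps ≡ 1 → UniqueRepeat o
    from (p ∷ []) eq _ = let (i , r , p≡) = ∈paths⇒pathOf (subst (p ∈_) (sym eq) (here refl)) in
      i , r , λ {j} rj → pathOf-injective rj (trans (only (subst (pathOf (o j) j ∈_) eq (pathOf∈paths rj))) p≡)
      where
      only : ∀ {q} → q ∈ p ∷ [] → q ≡ p
      only (here q≡p) = q≡p

theorem2p8 : ∀ (n : ℕ) → 1 ≤ n → ∀ (o : Orientation (2 * n)) →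
    (Acyclic o × MaximizesLinExt o → AlmostBipartite o) ×
    (Acyclic o × AlmostBipartite o → MaximizesLinExt o)
theorem2p8 n _ o = maximal⇒almostBipartite , almostBipartite⇒maximal
  where
  maximal⇒almostBipartite : Acyclic o × MaximizesLinExt o → AlmostBipartite o
  maximal⇒almostBipartite (_ , maximal) =
    [ unique⇒almostBipartite o
    , (λ (o′ , acyclic , lt) → contradiction (maximal o′ acyclic) (<⇒≱ lt))
    ]′ (unique-or-improvable (alternate-double n) o)

  almostBipartite⇒maximal : Acyclic o × AlmostBipartite o → MaximizesLinExt o
  almostBipartite⇒maximal (_ , ab) o′ _ = ≤-trans (zigzag-maximal (alternate-double n) o′)
    (≤-reflexive (sym (unique⇒zigzag o (almostBipartite⇒unique o ab))))
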